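{- There is no $3$-by-$40$ shorthand universal torus for the permutations of $\{0,1,2,3,4\}$ with $2$-by-$2$ windows.
   Context: A $3$-by-$40$ shorthand universal torus for the permutations of $\{0,1,2,3,4\}$ with $2$-by-$2$ windows is an array $T : \mathbb{Z}_3 \times \mathbb{Z}_{40} \to \{0,1,2,3,4\}$ (row indices modulo $3$, column indices modulo $40$) such that every word of length $4$ with pairwise distinct entries in $\{0,1,2,3,4\}$ is equal to the row-major reading $T(i,j)\,T(i,j+1)\,T(i+1,j)\,T(i+1,j+1)$ for exactly one position $(i,j)\in \mathbb{Z}_3\times\mathbb{Z}_{40}$. (Each such word encodes a permutation of five symbols by appending its missing symbol.) -}

module Defs where

open import Data.Fin using (Fin; toℕ)
open import Data.Nat using (ℕ; suc; NonZero)
open import Data.Nat.DivMod using (_mod_)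
open import Data.Product using (_×_; _,_; ∃!)
open import Data.Vec using (Vec; []; _∷_)
open import Data.Vec.Relation.Unary.Unique.Propositional using (Unique)
open import Relation.Binary.PropositionalEquality using (_≡_)

Torus : ℕ → ℕ → Set → Set
Torus r c A = Fin r → Fin c → A

-- Successor in ℤ/n, so that next (n ∸ 1) wraps around to 0
-- (unlike Data.Fin.suc, which changes the index).
next : ∀ {n} .{{_ : NonZero n}} → Fin n → Fin n
next {n} i = suc (toℕ i) mod n

window : ∀ {r c A} .{{_ : NonZero r}} .{{_ : NonZero c}} →
         Torus r c A → Fin r × Fin c → Vec A 4
window T (i , j) =
  T i j ∷ T i (next j) ∷ T (next i) j ∷ T (next i) (next j) ∷ []

-- A word of four distinct symbols out of five encodes a permutation of the
-- five symbols, by appending the missing symbol.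
IsShorthandUniversal : ∀ {r c} .{{_ : NonZero r}} .{{_ : NonZero c}} →
                       Torus r c (Fin 5) → Set
IsShorthandUniversal {r} {c} T =
  ∀ (w : Vec (Fin 5) 4) → Unique w →
  ∃! _≡_ λ (p : Fin r × Fin c) → window T p ≡ w

{-# OPTIONS --safe #-}
-- There are as many positions in the torus as words, so every window has four
-- distinct entries.  Since there are only three rows, any two of the six cells
-- in two adjacent columns share a window; hence these cells hold six distinct
-- symbols, but only five are available.
module Submission where

open import Defs
open import Data.Empty using (⊥-elim)
open import Data.Fin using (Fin; punchIn; punchOut; combine; remQuot)
open import Data.Fin.Patterns using (0F; 1F; 2F)
open import Data.Fin.Properties
  using (_≟_; any?; punchOut-injective; punchIn-injective; punchInᵢ≢i;
         combine-injective; combine-remQuot; <⇒notInjective)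
open import Data.Nat using (ℕ; zero; suc; NonZero; _+_; _*_; _<_)
open import Data.Nat.Properties using (n<1+n)
open import Data.Product using (∃; _×_; _,_; proj₁; proj₂; uncurry)
open import Data.Product.Properties using (×-≡,≡→≡)
open import Data.Vec using (Vec; []; _∷_; map)
open import Data.Vec.Properties using (∷-injectiveˡ; ∷-injectiveʳ)
open import Data.Vec.Relation.Unary.All as All using ([]; _∷_)
import Data.Vec.Relation.Unary.All.Properties as All
open import Data.Vec.Relation.Unary.AllPairs using ([]; _∷_)
open import Data.Vec.Relation.Unary.Unique.Propositional using (Unique)
import Data.Vec.Relation.Unary.Unique.Propositional.Properties as Unique
open import Function using (_∘_)
open import Function.Definitions using (Injective)
open import Relation.Binary.PropositionalEquality
  using (_≡_; refl; sym; trans; cong; cong₂; subst; ≢-sym)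
open import Relation.Nullary using (¬_; yes; no)

private variable
  m n k : ℕ
  A B : Set

-- If `y` were missed, punching it out of the codomain would inject `Fin (suc n)` into `Fin n`,
-- against the pigeonhole principle.
injective⇒surjective : {f : Fin n → Fin n} → Injective _≡_ _≡_ f →
                       ∀ y → ∃ λ x → f x ≡ y
injective⇒surjective {suc n} {f} f-inj y with any? (λ x → f x ≟ y)
... | yes hit = hit
... | no miss = ⊥-elim (<⇒notInjective (n<1+n n) punched-injective)
  where
  y≢f : ∀ x → ¬ y ≡ f x
  y≢f x y≡fx = miss (x , sym y≡fx)

  punched-injective : Injective _≡_ _≡_ (λ x → punchOut (y≢f x))
  punched-injective eq = f-inj (punchOut-injective (y≢f _) (y≢f _) eq)

map-injective : {f : A → B} → Injective _≡_ _≡_ f →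
                Injective _≡_ _≡_ (map {n = n} f)
map-injective f-inj {[]}     {[]}     _  = refl
map-injective f-inj {x ∷ xs} {y ∷ ys} eq =
  cong₂ _∷_ (f-inj (∷-injectiveˡ eq)) (map-injective f-inj (∷-injectiveʳ eq))

combine-pair-injective : Injective _≡_ _≡_ (uncurry (combine {m} {n}))
combine-pair-injective {x = i , j} {k , l} eq =
  ×-≡,≡→≡ (combine-injective i j k l eq)

remQuot-injective : ∀ m → Injective _≡_ _≡_ (remQuot {m} n)
remQuot-injective {n} m {i} {j} eq =
  trans (sym (combine-remQuot {m} n i))
        (trans (cong (uncurry combine) eq) (combine-remQuot {m} n j))

-- (m + k)! / m!, the number of words of k distinct letters out of k + m.
#words : ℕ → ℕ → ℕ
#words m zero    = 1
#words m (suc k) = suc (k + m) * #words m k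

-- Decodes a mixed-radix numeral, as in a Lehmer code: the leading digit is the first letter, and
-- `punchIn` relabels the rest of the word so as to skip that letter.
word : ∀ k → Fin (#words m k) → Vec (Fin (k + m)) k
word         zero    _ = []
word {m = m} (suc k) c =
  let i , c′ = remQuot {suc (k + m)} (#words m k) c
  in i ∷ map (punchIn i) (word k c′)

word-unique : ∀ k (c : Fin (#words m k)) → Unique (word k c)
word-unique         zero    _ = []
word-unique {m = m} (suc k) c =
  let i , c′ = remQuot {suc (k + m)} (#words m k) c
  in All.map⁺ (All.universal (λ j → ≢-sym (punchInᵢ≢i i j)) (word k c′))
     ∷ Unique.map⁺ (punchIn-injective i _ _) (word-unique k c′)

word-injective : ∀ k → Injective _≡_ _≡_ (word {m} k)
word-injective zero {Fin.zero} {Fin.zero} _ = refl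
word-injective {m} (suc k) {c} {d} eq =
  remQuot-injective (suc (k + m))
    (step _ _ _ _ (∷-injectiveˡ eq) (∷-injectiveʳ eq))
  where
  -- The digits are generalised to variables so that `i ≡ j` can be matched with `refl`.
  step : ∀ i j c′ d′ → i ≡ j →
         map (punchIn i) (word k c′) ≡ map (punchIn j) (word k d′) →
         (i , c′) ≡ (j , d′)
  step i .i c′ d′ refl eq′ =
    cong (i ,_) (word-injective k (map-injective (punchIn-injective i _ _) eq′))

-- Sending a word to its position is injective, since the window there gives the word back. By
-- counting it is also surjective, so every window is some `word 4 c`.
windows-unique : {T : Torus 3 40 (Fin 5)} → IsShorthandUniversal T →
                 ∀ p → Unique (window T p)
windows-unique {T} universal (i , j) =
  let c , eq = injective⇒surjective index-injective (combine i j)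
      position≡ = combine-pair-injective {y = i , j} eq
  in subst Unique (trans (sym (window-position c)) (cong (window T) position≡))
                  (word-unique 4 c)
  where
  position : Fin 120 → Fin 3 × Fin 40
  position c = proj₁ (universal (word {1} 4 c) (word-unique 4 c))

  window-position : ∀ c → window T (position c) ≡ word 4 c
  window-position c = proj₁ (proj₂ (universal (word 4 c) (word-unique 4 c)))

  -- Both `#words 1 4`, that is 5 · 4 · 3 · 2, and `3 * 40` evaluate to 120, which makes this a
  -- self-map of a finite set.
  index : Fin 120 → Fin 120
  index = uncurry combine ∘ position

  index-injective : Injective _≡_ _≡_ index
  index-injective {c} {d} eq = word-injective 4
    (trans (sym (window-position c))
      (trans (cong (window T) (combine-pair-injective eq)) (window-position d)))

-- Pigeonhole: looking up entries of `xs` is an injection from `Fin k` to `Fin n`.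
unique⇒≮ : {xs : Vec (Fin n) k} → Unique xs → ¬ (n < k)
unique⇒≮ u n<k = <⇒notInjective n<k (Unique.lookup-injective u _ _)

-- The rows `a b`, `c d`, `e f` are cyclically adjacent in pairs, so each pair of cells lies in one
-- of the three windows.
merge-windows : {a b c d e f : A} →
                Unique (a ∷ b ∷ c ∷ d ∷ []) →
                Unique (c ∷ d ∷ e ∷ f ∷ []) →
                Unique (e ∷ f ∷ a ∷ b ∷ []) →
                Unique (a ∷ b ∷ c ∷ d ∷ e ∷ f ∷ [])
merge-windows
  ((ab ∷ ac ∷ ad ∷ []) ∷ (bc ∷ bd ∷ []) ∷ _)
  ((cd ∷ ce ∷ cf ∷ []) ∷ (de ∷ df ∷ []) ∷ _)
  ((ef ∷ ea ∷ eb ∷ []) ∷ (fa ∷ fb ∷ []) ∷ _) =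
  -- The third window lists `e f` before `a b`, so its inequalities between these rows are reversed.
  (ab ∷ ac ∷ ad ∷ ≢-sym ea ∷ ≢-sym fa ∷ []) ∷
  (bc ∷ bd ∷ ≢-sym eb ∷ ≢-sym fb ∷ []) ∷
  (cd ∷ ce ∷ cf ∷ []) ∷
  (de ∷ df ∷ []) ∷
  (ef ∷ []) ∷
  [] ∷
  []

theorem2 : ¬ (∃ λ (T : Torus 3 40 (Fin 5)) → IsShorthandUniversal T)
-- The window at row `2F` wraps around to row `0F`, which supplies the third hypothesis.
theorem2 (T , universal) = unique⇒≮ (merge-windows (u 0F) (u 1F) (u 2F)) (n<1+n 5)
  where
  u : ∀ i → Unique (window T (i , 0F))
  u i = windows-unique universal (i , 0F)
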